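{- Let $n$ be a positive integer, and let $a_1 \leq a_2 \leq \cdots$ be a nondecreasing sequence of positive integers such that \[ \frac{1}{n} = \sum_{i=1}^{\infty} \frac{1}{a_i}, \] and such that $a_i \neq s_i(n)$ for some index $i$. Then \[ \liminf_{i\to\infty} a_i^{2^{ -i}} < c_n . \]
   Context: For a positive integer $n$, the generalized Sylvester sequence $(s_i(n))_{i\ge 1}$ is defined by $s_1(n) = n+1$ and $s_{i+1}(n) = s_i(n)^2 - s_i(n) + 1$ for $i \geq 1$ (for $n=1$ this is the ordinary Sylvester sequence $2,3,7,43,\dots$). The limit $\lim_{i\to\infty} s_i(n)^{2^{ -i}}$ exists, and $c_n$ denotes this limit. -}

module Defs where

open import Data.Nat as ℕ using (ℕ; zero; suc; _+_; _*_; _∸_)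
open import Data.Integer using (+_)
open import Data.Rational using (ℚ; _/_; 0ℚ; 1ℚ) renaming (_+_ to _+ℚ_; _*_ to _*ℚ_)

-- generalized Sylvester sequence: sylv n i = s_i(n) for i ≥ 1
-- (s_1(n) = n+1, s_{i+1} = s_i^2 - s_i + 1; value at i = 0 is a dummy, set to n)
sylv : ℕ → ℕ → ℕ
sylv n zero = n
sylv n (suc zero) = suc n
sylv n (suc (suc i)) = let s = sylv n (suc i) in s * s ∸ s + 1

-- reciprocal of a natural number as a rational (1/0 := 0, only used on positive inputs)
recip : ℕ → ℚ
recip zero = 0ℚ
recip (suc k) = (+ 1) / suc k

partialSum : (ℕ → ℕ) → ℕ → ℚ
partialSum a zero = 0ℚ
partialSum a (suc m) = partialSum a m +ℚ recip (a (suc m))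

_^ℚ_ : ℚ → ℕ → ℚ
q ^ℚ zero = 1ℚ
q ^ℚ suc k = q *ℚ (q ^ℚ k)

toℚ : ℕ → ℚ
toℚ k = (+ k) / 1

module Submission where

-- Let k be the number of initial terms in which a agrees with the Sylvester sequence.  The later terms
-- b₀ ≤ b₁ ≤ ⋯ satisfy Σ 1/bᵢ = 1/S with S = n s₁ ⋯ s_k, and b₀ ≥ S + 2.  Following Soundararajan, compare
-- 1/bᵢ with rationals βᵢ such that β₀ = 1/(S + 3/2) and 1/S − Σ_{i<m} βᵢ = (Π_{i<m} βᵢ)/S for m ≥ 2.  If
-- Σ_{i<m} 1/bᵢ exceeded Σ_{i<m} βᵢ for the first time at m, Abel summation would give Σ_{i<m} bᵢ βᵢ ≤ m, so
-- Π_{i<m} bᵢ βᵢ ≤ 1 by AM–GM; but S (Π_{i<m} bᵢ) (1/S − Σ_{i<m} 1/bᵢ) is a positive integer, a contradiction.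
-- Hence the remainders of Σ 1/bᵢ are at least those of Σ βᵢ, which have the form 1/Uᵢ with
-- Uᵢ₊₁ = Uᵢ (Uᵢ + 1).  If b_{i+2} ≥ 2 (Uᵢ + 1) held from some i on, the tails of Σ 1/bᵢ would be at most half
-- those of Σ βᵢ; so b_{i+2} < 2 (Uᵢ + 1) infinitely often.  The numbers sᵢ − 1 obey the same recursion as U,
-- and already exceed the corresponding U₁ by more than 1, so the two doubly exponential growth rates differ.

open import Defs
open import Data.Nat.Base as ℕ using (ℕ; zero; suc; z≤n; s≤s)
import Data.Nat.Properties as ℕ
open import Data.Integer.Base as ℤ using (+_)
import Data.Integer.Properties as ℤ
open import Data.Rational.Base
open import Data.Rational.Properties
import Data.Rational.Unnormalised.Base as ℚᵘ
import Data.Rational.Unnormalised.Properties as ℚᵘ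
open import Data.Product.Base using (_×_; _,_; ∃-syntax)
open import Data.Sum.Base using (_⊎_; inj₁; inj₂)
open import Data.Empty using (⊥-elim)
open import Function.Base using (_∘_)
open import Level using (0ℓ)
open import Relation.Nullary using (¬_; yes; no)
open import Relation.Nullary.Decidable using (dec⇒maybe)
open import Relation.Binary.PropositionalEquality
open import Tactic.RingSolver using (solve-∀)
open import Tactic.RingSolver.Core.AlmostCommutativeRing using (AlmostCommutativeRing; fromCommutativeRing)

ring : AlmostCommutativeRing 0ℓ 0ℓ
ring = fromCommutativeRing +-*-commutativeRing (λ p → dec⇒maybe (0ℚ ≟ p))

-- Ordered field arithmetic

≤-by : ∀ {x y d} → 0ℚ ≤ d → x + d ≡ y → x ≤ y
≤-by {x} {y} {d} 0≤d eq = subst₂ _≤_ (+-identityʳ x) eq (+-monoʳ-≤ x 0≤d)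

<-by : ∀ {x y d} → 0ℚ < d → x + d ≡ y → x < y
<-by {x} {y} {d} 0<d eq = subst₂ _<_ (+-identityʳ x) eq (+-monoʳ-< x 0<d)

x≤y⇒0≤y-x : ∀ {x y} → x ≤ y → 0ℚ ≤ y - x
x≤y⇒0≤y-x {x} {y} p = subst (_≤ y - x) (+-inverseʳ x) (+-monoˡ-≤ (- x) p)

x<y⇒0<y-x : ∀ {x y} → x < y → 0ℚ < y - x
x<y⇒0<y-x {x} {y} p = subst (_< y - x) (+-inverseʳ x) (+-monoˡ-< (- x) p)

x+[y-x]≡y : ∀ x y → x + (y - x) ≡ y
x+[y-x]≡y = solve-∀ ring

*-interchange : ∀ a b c d → a * b * (c * d) ≡ a * c * (b * d)
*-interchange = solve-∀ ring

0≤1 : 0ℚ ≤ 1ℚ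
0≤1 = nonNegative⁻¹ 1ℚ

0<1 : 0ℚ < 1ℚ
0<1 = positive⁻¹ 1ℚ

0≤+ : ∀ {x y} → 0ℚ ≤ x → 0ℚ ≤ y → 0ℚ ≤ x + y
0≤+ p q = +-mono-≤ p q

0<+ : ∀ {x y} → 0ℚ < x → 0ℚ ≤ y → 0ℚ < x + y
0<+ p q = +-mono-<-≤ p q

*-monoˡ : ∀ {x y z} → 0ℚ ≤ z → x ≤ y → z * x ≤ z * y
*-monoˡ {z = z} 0≤z = *-monoˡ-≤-nonNeg z {{nonNegative 0≤z}}

*-monoʳ : ∀ {x y z} → 0ℚ ≤ z → x ≤ y → x * z ≤ y * z
*-monoʳ {z = z} 0≤z = *-monoʳ-≤-nonNeg z {{nonNegative 0≤z}}

*-monoˡ-< : ∀ {x y z} → 0ℚ < z → x < y → z * x < z * y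
*-monoˡ-< {z = z} 0<z = *-monoʳ-<-pos z {{positive 0<z}}

*-mono : ∀ {x y z w} → 0ℚ ≤ x → x ≤ y → 0ℚ ≤ w → z ≤ w → x * z ≤ y * w
*-mono 0≤x x≤y 0≤w z≤w = ≤-trans (*-monoˡ 0≤x z≤w) (*-monoʳ 0≤w x≤y)

0≤* : ∀ {x y} → 0ℚ ≤ x → 0ℚ ≤ y → 0ℚ ≤ x * y
0≤* {x} {y} p q = subst (_≤ x * y) (*-zeroʳ x) (*-monoˡ p q)

0<* : ∀ {x y} → 0ℚ < x → 0ℚ < y → 0ℚ < x * y
0<* {x} {y} p q = subst (_< x * y) (*-zeroʳ x) (*-monoˡ-< p q)

0≤x² : ∀ x → 0ℚ ≤ x * x
0≤x² x with ≤-total 0ℚ x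
... | inj₁ p = 0≤* p p
... | inj₂ p = subst (0ℚ ≤_) (neg² x) (0≤* (neg-antimono-≤ p) (neg-antimono-≤ p))
  where
  neg² : ∀ x → (- x) * (- x) ≡ x * x
  neg² = solve-∀ ring

inv : ∀ x → 0ℚ < x → ℚ
inv x 0<x = (1/ x) {{>-nonZero 0<x}}

inv-inverse : ∀ x (0<x : 0ℚ < x) → x * inv x 0<x ≡ 1ℚ
inv-inverse x 0<x = *-inverseʳ x {{>-nonZero 0<x}}

cancel-0< : ∀ {x y} → 0ℚ ≤ x → 0ℚ < x * y → 0ℚ < y
cancel-0< {x} {y} 0≤x p = *-cancelˡ-<-nonNeg x {{nonNegative 0≤x}} (subst (_< x * y) (sym (*-zeroʳ x)) p)

0<inv : ∀ x (0<x : 0ℚ < x) → 0ℚ < inv x 0<x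
0<inv x 0<x = cancel-0< (<⇒≤ 0<x) (subst (0ℚ <_) (sym (inv-inverse x 0<x)) 0<1)

-- Embedding of the natural numbers

-- `toℚ k` is normalised through a gcd, so identities are moved to the unnormalised rationals, where
-- equality is cross-multiplication.
toℚᵘ-toℚ : ∀ k → toℚᵘ (toℚ k) ℚᵘ.≃ ℚᵘ.mkℚᵘ (+ k) 0
toℚᵘ-toℚ k = toℚᵘ-fromℚᵘ (ℚᵘ.mkℚᵘ (+ k) 0)

toℚ-+ : ∀ m n → toℚ (m ℕ.+ n) ≡ toℚ m + toℚ n
toℚ-+ m n = toℚᵘ-injective (ℚᵘ.≃-trans (toℚᵘ-toℚ (m ℕ.+ n)) (ℚᵘ.≃-trans (ℚᵘ.*≡* eq)
  (ℚᵘ.≃-sym (ℚᵘ.≃-trans (toℚᵘ-homo-+ (toℚ m) (toℚ n)) (ℚᵘ.+-cong (toℚᵘ-toℚ m) (toℚᵘ-toℚ n))))))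
  where
  eq : + (m ℕ.+ n) ℤ.* + 1 ≡ (+ m ℤ.* + 1 ℤ.+ + n ℤ.* + 1) ℤ.* + 1
  eq = cong (ℤ._* + 1) (trans (ℤ.pos-+ m n) (sym (cong₂ ℤ._+_ (ℤ.*-identityʳ (+ m)) (ℤ.*-identityʳ (+ n)))))

toℚ-* : ∀ m n → toℚ (m ℕ.* n) ≡ toℚ m * toℚ n
toℚ-* m n = toℚᵘ-injective (ℚᵘ.≃-trans (toℚᵘ-toℚ (m ℕ.* n)) (ℚᵘ.≃-trans (ℚᵘ.*≡* (cong (ℤ._* + 1) (ℤ.pos-* m n)))
  (ℚᵘ.≃-sym (ℚᵘ.≃-trans (toℚᵘ-homo-* (toℚ m) (toℚ n)) (ℚᵘ.*-cong (toℚᵘ-toℚ m) (toℚᵘ-toℚ n))))))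

0≤toℚ : ∀ k → 0ℚ ≤ toℚ k
0≤toℚ k = nonNegative⁻¹ (toℚ k) {{normalize-nonNeg k 1}}

toℚ-mono-≤ : ∀ {m n} → m ℕ.≤ n → toℚ m ≤ toℚ n
toℚ-mono-≤ {m} {n} m≤n = ≤-by (0≤toℚ (n ℕ.∸ m)) (trans (sym (toℚ-+ m (n ℕ.∸ m))) (cong toℚ (ℕ.m+[n∸m]≡n m≤n)))

toℚ-mono-< : ∀ {m n} → m ℕ.< n → toℚ m < toℚ n
toℚ-mono-< {m} p = <-≤-trans (<-by 0<1 (trans (+-comm (toℚ m) 1ℚ) (sym (toℚ-+ 1 m)))) (toℚ-mono-≤ p)

toℚ-cancel-< : ∀ {m n} → toℚ m < toℚ n → m ℕ.< n
toℚ-cancel-< {m} {n} p with m ℕ.<? n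
... | yes q = q
... | no ¬q = ⊥-elim (<-irrefl refl (<-≤-trans p (toℚ-mono-≤ (ℕ.≮⇒≥ ¬q))))

toℚ-suc : ∀ k → toℚ (suc k) ≡ toℚ k + 1ℚ
toℚ-suc k = trans (toℚ-+ 1 k) (+-comm 1ℚ (toℚ k))

0<toℚ : ∀ {k} → 1 ℕ.≤ k → 0ℚ < toℚ k
0<toℚ = toℚ-mono-<

0<recip : ∀ k → 1 ℕ.≤ k → 0ℚ < recip k
0<recip (suc k) _ = positive⁻¹ (recip (suc k)) {{normalize-pos 1 (suc k)}}

0≤recip : ∀ k → 0ℚ ≤ recip k
0≤recip zero = ≤-refl
0≤recip (suc k) = <⇒≤ (0<recip (suc k) (s≤s z≤n))

toℚ*recip : ∀ k → 1 ℕ.≤ k → toℚ k * recip k ≡ 1ℚ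
toℚ*recip (suc k) _ = toℚᵘ-injective (ℚᵘ.≃-trans (toℚᵘ-homo-* (toℚ (suc k)) (recip (suc k)))
  (ℚᵘ.≃-trans (ℚᵘ.*-cong (toℚᵘ-toℚ (suc k)) (toℚᵘ-fromℚᵘ (ℚᵘ.mkℚᵘ (+ 1) k)))
    (ℚᵘ.*≡* (cong +_ (eq (suc k))))))
  where
  eq : ∀ n → n ℕ.* 1 ℕ.* 1 ≡ 1 ℕ.* (1 ℕ.* n)
  eq n = trans (trans (ℕ.*-identityʳ (n ℕ.* 1)) (ℕ.*-identityʳ n)) (sym (trans (ℕ.*-identityˡ (1 ℕ.* n)) (ℕ.*-identityˡ n)))

-- Powers

^-pos : ∀ {x} → 0ℚ < x → ∀ n → 0ℚ < x ^ℚ n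
^-pos p zero = 0<1
^-pos p (suc n) = 0<* p (^-pos p n)

^-nonNeg : ∀ {x} → 0ℚ ≤ x → ∀ n → 0ℚ ≤ x ^ℚ n
^-nonNeg p zero = 0≤1
^-nonNeg p (suc n) = 0≤* p (^-nonNeg p n)

^-mono-≤ : ∀ {x y} → 0ℚ ≤ x → x ≤ y → ∀ n → x ^ℚ n ≤ y ^ℚ n
^-mono-≤ p q zero = ≤-refl
^-mono-≤ p q (suc n) = *-mono p q (^-nonNeg (≤-trans p q) n) (^-mono-≤ p q n)

1^ : ∀ n → 1ℚ ^ℚ n ≡ 1ℚ
1^ zero = refl
1^ (suc n) = trans (*-identityˡ (1ℚ ^ℚ n)) (1^ n)

^-+ : ∀ x m n → x ^ℚ (m ℕ.+ n) ≡ x ^ℚ m * x ^ℚ n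
^-+ x zero n = sym (*-identityˡ (x ^ℚ n))
^-+ x (suc m) n = trans (cong (x *_) (^-+ x m n)) (sym (*-assoc x (x ^ℚ m) (x ^ℚ n)))

^-* : ∀ x m n → x ^ℚ (m ℕ.* n) ≡ (x ^ℚ n) ^ℚ m
^-* x zero n = refl
^-* x (suc m) n = trans (^-+ x n (m ℕ.* n)) (cong (x ^ℚ n *_) (^-* x m n))

*-^ : ∀ x y n → (x * y) ^ℚ n ≡ x ^ℚ n * y ^ℚ n
*-^ x y zero = refl
*-^ x y (suc n) = trans (cong (x * y *_) (*-^ x y n)) (*-interchange x y (x ^ℚ n) (y ^ℚ n))

bernoulli : ∀ {x} → 0ℚ ≤ x → ∀ n → 1ℚ + toℚ n * x ≤ (1ℚ + x) ^ℚ n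
bernoulli {x} 0≤x zero = ≤-reflexive (trans (cong (λ t → 1ℚ + t) (*-zeroˡ x)) (+-identityʳ 1ℚ))
bernoulli {x} 0≤x (suc n) = ≤-trans
  (≤-by (0≤* (0≤toℚ n) (0≤x² x)) (trans (cong (λ t → 1ℚ + t * x + toℚ n * (x * x)) (toℚ-suc n)) (eq (toℚ n) x)))
  (*-monoˡ (0≤+ 0≤1 0≤x) (bernoulli 0≤x n))
  where
  eq : ∀ n x → 1ℚ + (n + 1ℚ) * x + n * (x * x) ≡ (1ℚ + x) * (1ℚ + n * x)
  eq = solve-∀ ring

-- Arithmetic-geometric mean inequality

sum : (ℕ → ℚ) → ℕ → ℚ
sum f zero = 0ℚ
sum f (suc m) = sum f m + f m

prod : (ℕ → ℚ) → ℕ → ℚ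
prod f zero = 1ℚ
prod f (suc m) = prod f m * f m

0≤sum : ∀ {f} → (∀ i → 0ℚ ≤ f i) → ∀ m → 0ℚ ≤ sum f m
0≤sum p zero = ≤-refl
0≤sum p (suc m) = 0≤+ (0≤sum p m) (p m)

0<prod : ∀ {f} → (∀ i → 0ℚ < f i) → ∀ m → 0ℚ < prod f m
0<prod p zero = 0<1
0<prod p (suc m) = 0<* (0<prod p m) (p m)

prod-* : ∀ f g m → prod (λ i → f i * g i) m ≡ prod f m * prod g m
prod-* f g zero = refl
prod-* f g (suc m) = trans (cong (_* (f m * g m)) (prod-* f g m)) (*-interchange (prod f m) (prod g m) (f m) (g m))

-- By induction: the difference of the two sides for m + 1 is z times the difference for m, plus (m
-- + 1) yᵐ (z - y)².
weighted-amgm : ∀ m {y z} → 0ℚ ≤ y → 0ℚ ≤ z →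
  (toℚ m + 1ℚ) * (y ^ℚ m * z) ≤ z ^ℚ suc m + toℚ m * y ^ℚ suc m
weighted-amgm zero {y} {z} _ _ = ≤-reflexive (eq y z)
  where
  eq : ∀ y z → (0ℚ + 1ℚ) * (1ℚ * z) ≡ z * 1ℚ + 0ℚ * (y * 1ℚ)
  eq = solve-∀ ring
weighted-amgm (suc m) {y} {z} 0≤y 0≤z rewrite toℚ-suc m = ≤-by
  (0≤+ (0≤* 0≤z (x≤y⇒0≤y-x (weighted-amgm m 0≤y 0≤z)))
       (0≤* (0≤* (0≤+ (0≤toℚ m) 0≤1) (^-nonNeg 0≤y m)) (0≤x² (z - y))))
  (eq y z (y ^ℚ m) (z ^ℚ suc m) (toℚ m))
  where
  eq : ∀ y z b c m →
    (m + 1ℚ + 1ℚ) * (y * b * z) + (z * (c + m * (y * b) - (m + 1ℚ) * (b * z)) + (m + 1ℚ) * b * ((z - y) * (z - y)))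
    ≡ z * c + (m + 1ℚ) * (y * (y * b))
  eq = solve-∀ ring

toℚ-mean : ∀ f m → toℚ m * (sum f m * recip m) ≡ sum f m
-- Since `recip 0` is 0, the mean of no terms is 0, so the inductive step of `amgm` also covers m =
-- 0.
toℚ-mean f zero = refl
toℚ-mean f (suc m) = trans (eq (toℚ (suc m)) (sum f (suc m)) (recip (suc m)))
  (trans (cong (sum f (suc m) *_) (toℚ*recip (suc m) (s≤s z≤n))) (*-identityʳ _))
  where
  eq : ∀ a b c → a * (b * c) ≡ b * (a * c)
  eq = solve-∀ ring

-- If B is the mean of the first m terms and A that of all m + 1, the last term is (m + 1) A - m B,
-- and `weighted-amgm` at B and A bounds Bᵐ times it by Aᵐ⁺¹.
amgm : ∀ {f} → (∀ i → 0ℚ ≤ f i) → ∀ m A → 0ℚ ≤ A → toℚ m * A ≡ sum f m → prod f m ≤ A ^ℚ m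
amgm 0≤f zero A 0≤A eq = ≤-refl
amgm {f} 0≤f (suc m) A 0≤A eq = begin
  prod f m * f m ≤⟨ *-monoʳ (0≤f m) (amgm 0≤f m B 0≤B (toℚ-mean f m)) ⟩
  B ^ℚ m * f m ≡⟨ cong (B ^ℚ m *_) f≡ ⟩
  B ^ℚ m * ((toℚ m + 1ℚ) * A - toℚ m * B) ≤⟨ ≤-by (x≤y⇒0≤y-x (weighted-amgm m 0≤B 0≤A)) (rearrange A B (B ^ℚ m) (A ^ℚ suc m) (toℚ m)) ⟩
  A ^ℚ suc m ∎
  where
  open ≤-Reasoning
  B : ℚ
  B = sum f m * recip m
  0≤B : 0ℚ ≤ B
  0≤B = 0≤* (0≤sum 0≤f m) (0≤recip m)
  cancel : ∀ s x → s + x - s ≡ x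
  cancel = solve-∀ ring
  f≡ : f m ≡ (toℚ m + 1ℚ) * A - toℚ m * B
  f≡ = trans (sym (cancel (sum f m) (f m)))
    (cong₂ _-_ (trans (sym eq) (cong (_* A) (toℚ-suc m))) (sym (toℚ-mean f m)))
  rearrange : ∀ A B b a m → b * ((m + 1ℚ) * A - m * B) + (a + m * (B * b) - (m + 1ℚ) * (b * A)) ≡ a
  rearrange = solve-∀ ring

sum≤⇒prod≤1 : ∀ {f} → (∀ i → 0ℚ ≤ f i) → ∀ m → sum f m ≤ toℚ m → prod f m ≤ 1ℚ
sum≤⇒prod≤1 {f} 0≤f zero _ = ≤-refl
sum≤⇒prod≤1 {f} 0≤f (suc n) p = begin
  prod f m ≤⟨ amgm 0≤f m A 0≤A (toℚ-mean f m) ⟩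
  A ^ℚ m ≤⟨ ^-mono-≤ 0≤A A≤1 m ⟩
  1ℚ ^ℚ m ≡⟨ 1^ m ⟩
  1ℚ ∎
  where
  open ≤-Reasoning
  m : ℕ
  m = suc n
  A : ℚ
  A = sum f m * recip m
  0≤A : 0ℚ ≤ A
  0≤A = 0≤* (0≤sum 0≤f m) (0≤recip m)
  A≤1 : A ≤ 1ℚ
  A≤1 = subst (A ≤_) (toℚ*recip m (s≤s z≤n)) (*-monoʳ (0≤recip m) p)

-- Soundararajan's comparison

module _ (a α β : ℕ → ℚ) (0≤a : ∀ i → 0ℚ ≤ a i) (a-mono : ∀ i → a i ≤ a (suc i))
         (a*α : ∀ i → a i * α i ≡ 1ℚ) (0≤β : ∀ i → 0ℚ ≤ β i) where

  -- As aᵢ αᵢ = 1, the excess of Σ aᵢ βᵢ over the number of terms is Σ aᵢ (βᵢ - αᵢ). Summation by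
  -- parts leaves the boundary term, minus increments of a times earlier differences of partial
  -- sums, which are nonnegative. Domination is assumed only up to m, so the boundary difference may
  -- have either sign.
  abel : ∀ m → (∀ j → j ℕ.≤ m → sum α j ≤ sum β j) →
    sum (λ i → a i * β i) (suc m) ≤ toℚ (suc m) + a m * (sum β (suc m) - sum α (suc m))
  abel m p = subst₂ _≤_ refl (trans (rearrange (toℚ m) (a m) (β m) (α m) (sum β m) (sum α m)) rest)
      (+-monoˡ-≤ (a m * β m) (prefix m p))
    where
    rearrange : ∀ t a b c s r → t + a * (s - r) + a * b ≡ t + a * c + a * (s + b - (r + c))
    rearrange = solve-∀ ring
    rest : toℚ m + a m * α m + a m * (sum β (suc m) - sum α (suc m)) ≡ toℚ (suc m) + a m * (sum β (suc m) - sum α (suc m))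
    rest = cong (_+ a m * (sum β (suc m) - sum α (suc m))) (trans (cong (λ t → toℚ m + t) (a*α m)) (sym (toℚ-suc m)))
    prefix : ∀ m → (∀ j → j ℕ.≤ m → sum α j ≤ sum β j) → sum (λ i → a i * β i) m ≤ toℚ m + a m * (sum β m - sum α m)
    prefix zero p = ≤-reflexive (sym (zeros (a 0)))
      where
      zeros : ∀ x → 0ℚ + x * (0ℚ - 0ℚ) ≡ 0ℚ
      zeros = solve-∀ ring
    -- The weight rises from `a m` to `a (suc m)` on a nonnegative difference.
    prefix (suc m) p = ≤-trans (abel m (λ j j≤m → p j (ℕ.m≤n⇒m≤1+n j≤m)))
      (+-monoʳ-≤ (toℚ (suc m)) (*-monoʳ (x≤y⇒0≤y-x (p (suc m) ℕ.≤-refl)) (a-mono m)))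

  first-reversal⇒prod≤1 : ∀ m → (∀ j → j ℕ.≤ m → sum α j ≤ sum β j) → sum β (suc m) ≤ sum α (suc m) →
    prod a (suc m) * prod β (suc m) ≤ 1ℚ
  first-reversal⇒prod≤1 m p q = subst (_≤ 1ℚ) (prod-* a β (suc m))
    (sum≤⇒prod≤1 (λ i → 0≤* (0≤a i) (0≤β i)) (suc m)
      (≤-trans (abel m p)
        (≤-by (0≤* (0≤a m) (x≤y⇒0≤y-x q)) (cancel (toℚ (suc m)) (a m) (sum β (suc m)) (sum α (suc m))))))
    where
    cancel : ∀ t a s r → t + a * (s - r) + a * (r - s) ≡ t
    cancel = solve-∀ ring

-- Integrality of the remainder

prod-toℚ : ∀ (a : ℕ → ℕ) m → ∃[ P ] toℚ P ≡ prod (toℚ ∘ a) m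
prod-toℚ a zero = 1 , refl
prod-toℚ a (suc m) with prod-toℚ a m
... | P , eq = P ℕ.* a m , trans (toℚ-* P (a m)) (cong (_* toℚ (a m)) eq)

common-denominator : ∀ (a : ℕ → ℕ) → (∀ i → 1 ℕ.≤ a i) → ∀ m →
  ∃[ N ] toℚ N ≡ prod (toℚ ∘ a) m * sum (recip ∘ a) m
common-denominator a 1≤a zero = 0 , refl
common-denominator a 1≤a (suc m) with common-denominator a 1≤a m | prod-toℚ a m
... | N , eN | P , eP = N ℕ.* a m ℕ.+ P , (begin
  toℚ (N ℕ.* a m ℕ.+ P) ≡⟨ toℚ-+ (N ℕ.* a m) P ⟩
  toℚ (N ℕ.* a m) + toℚ P ≡⟨ cong₂ _+_ (trans (toℚ-* N (a m)) (cong (_* toℚ (a m)) eN)) (trans eP (sym (*-identityʳ _))) ⟩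
  Π * σ * x + Π * 1ℚ ≡⟨ cong (λ t → Π * σ * x + Π * t) (sym (toℚ*recip (a m) (1≤a m))) ⟩
  Π * σ * x + Π * (x * recip (a m)) ≡⟨ rearrange Π σ x (recip (a m)) ⟩
  Π * x * (σ + recip (a m)) ∎)
  where
  open ≡-Reasoning
  Π σ x : ℚ
  Π = prod (toℚ ∘ a) m
  σ = sum (recip ∘ a) m
  x = toℚ (a m)
  rearrange : ∀ p s x y → p * s * x + p * (x * y) ≡ p * x * (s + y)
  rearrange = solve-∀ ring

-- Multiplied out, the right-hand side is P - S N, with P the product of the terms and N from
-- `common-denominator`. It is a positive difference of natural numbers, hence at least 1.
remainder-lower-bound : ∀ S (a : ℕ → ℕ) → 1 ℕ.≤ S → (∀ i → 1 ℕ.≤ a i) → ∀ m → sum (recip ∘ a) m < recip S →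
  1ℚ ≤ toℚ S * prod (toℚ ∘ a) m * (recip S - sum (recip ∘ a) m)
remainder-lower-bound S a 1≤S 1≤a m lt with common-denominator a 1≤a m | prod-toℚ a m
... | N , eN | P , eP = subst (1ℚ ≤_) (sym value)
    (≤-by (x≤y⇒0≤y-x (toℚ-mono-≤ SN<P)) (trans (cong (λ t → 1ℚ + (toℚ P - t)) (toℚ-suc (S ℕ.* N))) (cancel (toℚ P) (toℚ (S ℕ.* N)))))
  where
  Π σ : ℚ
  Π = prod (toℚ ∘ a) m
  σ = sum (recip ∘ a) m
  cancel : ∀ p t → 1ℚ + (p - (t + 1ℚ)) ≡ p - t
  cancel = solve-∀ ring
  expand : ∀ s p r t → s * p * (r - t) ≡ s * r * p - s * (p * t)
  expand = solve-∀ ring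
  value : toℚ S * Π * (recip S - σ) ≡ toℚ P - toℚ (S ℕ.* N)
  value = trans (expand (toℚ S) Π (recip S) σ) (cong₂ _-_
    (trans (cong (_* Π) (toℚ*recip S 1≤S)) (trans (*-identityˡ Π) (sym eP)))
    (trans (cong (toℚ S *_) (sym eN)) (sym (toℚ-* S N))))
  0<Π : 0ℚ < Π
  0<Π = 0<prod (λ i → 0<toℚ (1≤a i)) m
  SN<P : S ℕ.* N ℕ.< P
  SN<P = toℚ-cancel-< (<-by (subst (0ℚ <_) value (0<* (0<* (0<toℚ 1≤S) 0<Π) (x<y⇒0<y-x lt))) (x+[y-x]≡y (toℚ (S ℕ.* N)) (toℚ P)))

-- The extremal sequence after a deviation

2ℚ 3ℚ : ℚ
2ℚ = toℚ 2
3ℚ = toℚ 3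

-- Here u and v are the reciprocals of x and y, and the claim is p y ≤ q x multiplied by u v. Giving
-- reciprocals by equations lets both `recip` and `inv` fit.
reciprocal-anti : ∀ x u y v p q → 0ℚ ≤ u → 0ℚ ≤ v → x * u ≡ 1ℚ → y * v ≡ 1ℚ → p * y ≤ q * x → p * u ≤ q * v
reciprocal-anti x u y v p q 0≤u 0≤v xu yv le = ≤-by (0≤* (0≤* 0≤u 0≤v) (x≤y⇒0≤y-x le))
  (trans (expand p q x u y v) (trans (cong₂ (λ e f → p * u + (q * v * e - p * u * f)) xu yv) (collapse (p * u) (q * v))))
  where
  expand : ∀ p q x u y v → p * u + u * v * (q * x - p * y) ≡ p * u + (q * v * (x * u) - p * u * (y * v))
  expand = solve-∀ ring
  collapse : ∀ a b → a + (b * 1ℚ - a * 1ℚ) ≡ b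
  collapse = solve-∀ ring

<-or-≥ : ∀ x y → x < y ⊎ y ≤ x
<-or-≥ x y with x <? y
... | yes p = inj₁ p
... | no ¬p = inj₂ (≮⇒≥ ¬p)

-- Takes the place of an argument by contradiction: a witness is found constructively once the
-- caller has a bound within which one is forced to occur.
bounded-search : ∀ {P Q : ℕ → Set} → (∀ j → P j ⊎ Q j) → ∀ n → (∃[ j ] P j) ⊎ (∀ j → j ℕ.< n → Q j)
bounded-search d zero = inj₂ λ _ ()
bounded-search {P} {Q} d (suc n) with bounded-search {P} {Q} d n | d n
... | inj₁ p | _ = inj₁ p
... | inj₂ _ | inj₁ p = inj₁ (n , p)
... | inj₂ f | inj₂ q = inj₂ λ j j<1+n → case-≤ (ℕ.m≤n⇒m<n∨m≡n (ℕ.≤-pred j<1+n))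
  where
  case-≤ : ∀ {j} → j ℕ.< n ⊎ j ≡ n → Q j
  case-≤ (inj₁ j<n) = f _ j<n
  case-≤ (inj₂ refl) = q

module Deviation (S : ℕ) (1≤S : 1 ℕ.≤ S) where

  -- β₀ = 2 / D₁ is 1 / (s + 3/2). Solving 1 - s β₀ - s β₁ = β₀ β₁ gives β₁ = (1 - s β₀) / (s + β₀)
  -- = 3 / D₂.
  s D₁ D₂ : ℚ
  s = toℚ S
  D₁ = 2ℚ * s + 3ℚ
  D₂ = 2ℚ * s * s + 3ℚ * s + 2ℚ

  0<s : 0ℚ < s
  0<s = 0<toℚ 1≤S

  1≤s : 1ℚ ≤ s
  1≤s = toℚ-mono-≤ 1≤S

  0<2 : 0ℚ < 2ℚ
  0<2 = positive⁻¹ 2ℚ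

  0<3 : 0ℚ < 3ℚ
  0<3 = positive⁻¹ 3ℚ

  0<D₁ : 0ℚ < D₁
  0<D₁ = 0<+ (0<* 0<2 0<s) (<⇒≤ 0<3)

  0<D₂ : 0ℚ < D₂
  0<D₂ = 0<+ (0<+ (0<* (0<* 0<2 0<s) 0<s) (<⇒≤ (0<* 0<3 0<s))) (<⇒≤ 0<2)

  -- β 0 lies above 1/(S + 2) because starting from 1/(S + 2) would, for S = 1, give U 0 = 6, which is
  -- the Sylvester value.  β 1 makes the remainder 1/S − β 0 − β 1 equal to β 0 β 1 / S = 1 / U 0.
  U : ℕ → ℚ
  U zero = s * D₁ * D₂ * recip 6
  U (suc i) = U i * (U i + 1ℚ)

  0<U : ∀ i → 0ℚ < U i
  0<U zero = 0<* (0<* (0<* 0<s 0<D₁) 0<D₂) (0<recip 6 (s≤s z≤n))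
  0<U (suc i) = 0<* (0<U i) (0<+ (0<U i) 0≤1)

  0<U+1 : ∀ i → 0ℚ < U i + 1ℚ
  0<U+1 i = 0<+ (0<U i) 0≤1

  -- From index 2 on, each term is the first part of 1/U = 1/(U + 1) + 1/(U (U + 1)), whose second
  -- part is the next remainder.
  β : ℕ → ℚ
  β 0 = 2ℚ * inv D₁ 0<D₁
  β 1 = 3ℚ * inv D₂ 0<D₂
  β (suc (suc i)) = inv (U i + 1ℚ) (0<U+1 i)

  0<β : ∀ i → 0ℚ < β i
  0<β 0 = 0<* 0<2 (0<inv D₁ 0<D₁)
  0<β 1 = 0<* 0<3 (0<inv D₂ 0<D₂)
  0<β (suc (suc i)) = 0<inv (U i + 1ℚ) (0<U+1 i)

  -- Together with `s*remainder` this makes the remainder of β after i + 2 terms equal to 1 / `U i`.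
  -- At each step U gains the factor U + 1 by which the product is divided.
  U*prodβ : ∀ i → U i * prod β (suc (suc i)) ≡ s
  U*prodβ zero = trans (regroup s D₁ D₂ (inv D₁ 0<D₁) (inv D₂ 0<D₂))
    (trans (cong₂ (λ e f → s * e * f) (inv-inverse D₁ 0<D₁) (inv-inverse D₂ 0<D₂)) (ones s))
    where
    regroup : ∀ s d e v w → s * d * e * recip 6 * (1ℚ * (2ℚ * v) * (3ℚ * w)) ≡ s * (d * v) * (e * w)
    regroup = solve-∀ ring
    ones : ∀ s → s * 1ℚ * 1ℚ ≡ s
    ones = solve-∀ ring
  U*prodβ (suc i) = trans (regroup (U i) (prod β (suc (suc i))) (β (suc (suc i))))
    (trans (cong₂ _*_ (U*prodβ i) (inv-inverse (U i + 1ℚ) (0<U+1 i))) (*-identityʳ s))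
    where
    regroup : ∀ u p b → u * (u + 1ℚ) * (p * b) ≡ u * p * ((u + 1ℚ) * b)
    regroup = solve-∀ ring

  1-s*sumβ : ∀ i → 1ℚ - s * sum β (suc (suc i)) ≡ prod β (suc (suc i))
  -- Inserting factors 1 = D₁ v₁ = D₂ v₂ turns the claim into a polynomial identity in s, v₁ and v₂.
  1-s*sumβ zero = trans (ones s v₁ v₂) (trans (sym (cong₂ (λ e f → e * f - s * (0ℚ + 2ℚ * v₁ * f + 3ℚ * v₂ * e)) (inv-inverse D₁ 0<D₁) (inv-inverse D₂ 0<D₂)))
    (expand s v₁ v₂))
    where
    v₁ v₂ : ℚ
    v₁ = inv D₁ 0<D₁
    v₂ = inv D₂ 0<D₂
    ones : ∀ s v w → 1ℚ - s * (0ℚ + 2ℚ * v + 3ℚ * w) ≡ 1ℚ * 1ℚ - s * (0ℚ + 2ℚ * v * 1ℚ + 3ℚ * w * 1ℚ)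
    ones = solve-∀ ring
    expand : ∀ s v w → (2ℚ * s + 3ℚ) * v * ((2ℚ * s * s + 3ℚ * s + 2ℚ) * w)
        - s * (0ℚ + 2ℚ * v * ((2ℚ * s * s + 3ℚ * s + 2ℚ) * w) + 3ℚ * w * ((2ℚ * s + 3ℚ) * v))
      ≡ 1ℚ * (2ℚ * v) * (3ℚ * w)
    expand = solve-∀ ring
  1-s*sumβ (suc i) = begin
    1ℚ - s * (sum β m + b) ≡⟨ split s (sum β m) b ⟩
    1ℚ - s * sum β m - s * b ≡⟨ cong₂ (λ x y → x - y * b) (1-s*sumβ i) (sym (U*prodβ i)) ⟩
    p - u * p * b ≡⟨ cong (_- u * p * b) (trans (sym (*-identityʳ p)) (cong (p *_) (sym (inv-inverse (u + 1ℚ) (0<U+1 i))))) ⟩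
    p * ((u + 1ℚ) * b) - u * p * b ≡⟨ collapse p u b ⟩
    p * b ∎
    where
    open ≡-Reasoning
    m : ℕ
    m = suc (suc i)
    u p b : ℚ
    u = U i
    p = prod β m
    b = β m
    split : ∀ s t b → 1ℚ - s * (t + b) ≡ 1ℚ - s * t - s * b
    split = solve-∀ ring
    collapse : ∀ p u b → p * ((u + 1ℚ) * b) - u * p * b ≡ p * b
    collapse = solve-∀ ring

  s*remainder : ∀ i → s * (recip S - sum β (suc (suc i))) ≡ prod β (suc (suc i))
  s*remainder i = trans (split s (recip S) (sum β (suc (suc i))))
    (trans (cong (_- s * sum β (suc (suc i))) (toℚ*recip S 1≤S)) (1-s*sumβ i))
    where
    split : ∀ s r t → s * (r - t) ≡ s * r - s * t
    split = solve-∀ ring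

  0<remainder : ∀ i → 0ℚ < recip S - sum β (suc (suc i))
  0<remainder i = cancel-0< (<⇒≤ 0<s) (subst (0ℚ <_) (sym (s*remainder i)) (0<prod 0<β (suc (suc i))))

  module _ (b : ℕ → ℕ) (1≤b : ∀ i → 1 ℕ.≤ b i) (b-mono : ∀ i → b i ℕ.≤ b (suc i))
           (S+2≤b₀ : S ℕ.+ 2 ℕ.≤ b 0) (under : ∀ m → sum (recip ∘ b) m < recip S) where

    α : ℕ → ℚ
    α = recip ∘ b

    toℚb*α : ∀ i → toℚ (b i) * α i ≡ 1ℚ
    toℚb*α i = toℚ*recip (b i) (1≤b i)

    -- b₀ ≥ S + 2 exceeds S + 3/2; doubled, D₁ + 1 = 2 (S + 2) ≤ 2 b₀.
    α₀≤β₀ : α 0 ≤ β 0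
    α₀≤β₀ = subst (_≤ β 0) (*-identityˡ (α 0))
      (reciprocal-anti (toℚ (b 0)) (α 0) D₁ (inv D₁ 0<D₁) 1ℚ 2ℚ (0≤recip (b 0)) (<⇒≤ (0<inv D₁ 0<D₁)) (toℚb*α 0) (inv-inverse D₁ 0<D₁)
        (≤-trans (≤-by 0≤1 (eq s)) (*-monoˡ (<⇒≤ 0<2) (subst (_≤ toℚ (b 0)) (toℚ-+ S 2) (toℚ-mono-≤ S+2≤b₀)))))
      where
      eq : ∀ s → 1ℚ * (2ℚ * s + 3ℚ) + 1ℚ ≡ 2ℚ * (s + 2ℚ)
      eq = solve-∀ ring

    -- A reversal would put the integrality bound 1 strictly below the AM-GM bound 1. The argument
    -- starts at two terms because `s*remainder` has no analogue for one: 1 - s β₀ = 3 / D₁, while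
    -- β₀ = 2 / D₁.
    no-reversal : ∀ i → (∀ j → j ℕ.≤ suc i → sum α j ≤ sum β j) → sum α (suc (suc i)) ≤ sum β (suc (suc i))
    no-reversal i dom = ≮⇒≥ λ β<α → <-irrefl refl (begin-strict
      1ℚ ≤⟨ remainder-lower-bound S b 1≤S 1≤b m (under m) ⟩
      s * Π * (recip S - sum α m) <⟨ *-monoˡ-< (0<* 0<s (0<prod (λ i → 0<toℚ (1≤b i)) m)) (+-monoʳ-< (recip S) (neg-antimono-< β<α)) ⟩
      s * Π * (recip S - sum β m) ≡⟨ swap s Π (recip S - sum β m) ⟩
      Π * (s * (recip S - sum β m)) ≡⟨ cong (Π *_) (s*remainder i) ⟩
      Π * prod β m ≤⟨ first-reversal⇒prod≤1 (toℚ ∘ b) α β (λ i → 0≤toℚ (b i)) (λ i → toℚ-mono-≤ (b-mono i)) toℚb*α (λ i → <⇒≤ (0<β i)) (suc i) dom (<⇒≤ β<α) ⟩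
      1ℚ ∎)
      where
      open ≤-Reasoning
      m : ℕ
      m = suc (suc i)
      Π : ℚ
      Π = prod (toℚ ∘ b) m
      swap : ∀ s p r → s * p * r ≡ p * (s * r)
      swap = solve-∀ ring

    dominated : ∀ m j → j ℕ.≤ m → sum α j ≤ sum β j
    dominated zero zero z≤n = ≤-refl
    dominated (suc m) j j≤1+m with ℕ.m≤n⇒m<n∨m≡n j≤1+m
    ... | inj₁ j<1+m = dominated m j (ℕ.≤-pred j<1+m)
    dominated (suc zero) .1 _ | inj₂ refl = +-monoʳ-≤ 0ℚ α₀≤β₀
    dominated (suc (suc i)) _ _ | inj₂ refl = no-reversal i (dominated (suc i))

    -- Between the two cut-offs α spends at most half of what β spends, and β never exhausts 1/S.
    -- Starting from a remainder at least that of β, α therefore keeps at least half of β's initial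
    -- remainder, however large M is.
    large⇒remainder : ∀ M N → (∀ j → j ℕ.< M → 2ℚ * (U (j ℕ.+ N) + 1ℚ) ≤ toℚ (b (suc (suc (j ℕ.+ N))))) →
      recip S - sum β (suc (suc N)) ≤ 2ℚ * (recip S - sum α (suc (suc (M ℕ.+ N))))
    large⇒remainder M N large =
      ≤-by (0≤+ (0≤+ (x≤y⇒0≤y-x (tail M ℕ.≤-refl)) (<⇒≤ (0<remainder (M ℕ.+ N))))
                (0≤* (<⇒≤ 0<2) (x≤y⇒0≤y-x (dominated m₀ m₀ ℕ.≤-refl))))
           (combine (recip S) (sum β m₀) (sum β m₁) (sum α m₀) (sum α m₁))
      where
      m₀ m₁ : ℕ
      m₀ = suc (suc N)
      m₁ = suc (suc (M ℕ.+ N))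
      combine : ∀ r s₀ s₁ a₀ a₁ → r - s₀ + (s₁ - s₀ - 2ℚ * (a₁ - a₀) + (r - s₁) + 2ℚ * (s₀ - a₀)) ≡ 2ℚ * (r - a₁)
      combine = solve-∀ ring
      tail : ∀ j → j ℕ.≤ M → 2ℚ * (sum α (suc (suc (j ℕ.+ N))) - sum α m₀) ≤ sum β (suc (suc (j ℕ.+ N))) - sum β m₀
      tail zero _ = ≤-reflexive (zeros (sum α m₀) (sum β m₀))
        where
        zeros : ∀ x y → 2ℚ * (x - x) ≡ y - y
        zeros = solve-∀ ring
      tail (suc j) j<M = subst₂ _≤_
        (split-α (sum α m) (sum α m₀) (α m)) (split-β (sum β m) (sum β m₀) (β m))
        (+-mono-≤ (tail j (ℕ.<⇒≤ j<M))
          (reciprocal-anti (toℚ (b m)) (α m) (U (j ℕ.+ N) + 1ℚ) (β m) 2ℚ 1ℚ (0≤recip (b m)) (<⇒≤ (0<β m)) (toℚb*α m) (inv-inverse _ (0<U+1 (j ℕ.+ N)))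
            (≤-trans (large j j<M) (≤-reflexive (sym (*-identityˡ _))))))
        where
        m : ℕ
        m = suc (suc (j ℕ.+ N))
        split-α : ∀ x y z → 2ℚ * (x - y) + 2ℚ * z ≡ 2ℚ * (x + z - y)
        split-α = solve-∀ ring
        split-β : ∀ x y z → x - y + 1ℚ * z ≡ x + z - y
        split-β = solve-∀ ring

    -- Let R > 0 be the remainder of β after N + 2 terms. Convergence gives an M beyond which the
    -- remainder of α is below R / 2; if every index from N to N + M - 1 were large,
    -- `large⇒remainder` would contradict this.
    infinitely-often-small : (∀ ε → 0ℚ < ε → ∃[ M ] (∀ m → M ℕ.≤ m → recip S - sum α m < ε)) →
      ∀ N → ∃[ i ] (N ℕ.≤ i × toℚ (b (suc (suc i))) < 2ℚ * (U i + 1ℚ))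
    infinitely-often-small converges N = from-close (converges (½ * R) (0<* (positive⁻¹ ½) (0<remainder N)))
      where
      R : ℚ
      R = recip S - sum β (suc (suc N))
      Small Large : ℕ → Set
      Small i = toℚ (b (suc (suc i))) < 2ℚ * (U i + 1ℚ)
      Large i = 2ℚ * (U i + 1ℚ) ≤ toℚ (b (suc (suc i)))
      double : ∀ x → 2ℚ * (½ * x) ≡ x
      double = solve-∀ ring
      from-close : ∃[ M ] (∀ m → M ℕ.≤ m → recip S - sum α m < ½ * R) → ∃[ i ] (N ℕ.≤ i × Small i)
      from-close (M , close) = from-search (bounded-search {λ j → Small (j ℕ.+ N)} {λ j → Large (j ℕ.+ N)} (λ j → <-or-≥ _ _) M)
        where
        from-search : (∃[ j ] Small (j ℕ.+ N)) ⊎ (∀ j → j ℕ.< M → Large (j ℕ.+ N)) → ∃[ i ] (N ℕ.≤ i × Small i)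
        from-search (inj₁ (j , small)) = j ℕ.+ N , ℕ.m≤n+m N j , small
        from-search (inj₂ large) = ⊥-elim (<-irrefl refl (≤-<-trans (large⇒remainder M N large)
          (subst (2ℚ * (recip S - sum α m) <_) (double R) (*-monoˡ-< 0<2 (close m (ℕ.m≤n⇒m≤1+n (ℕ.m≤n⇒m≤1+n (ℕ.m≤m+n M N))))))))
          where
          m : ℕ
          m = suc (suc (M ℕ.+ N))

-- Doubly exponential growth

-- sylvPred n i = s_{i+1}(n) − 1 = n s_1(n) ⋯ s_i(n); its reciprocal is 1/n − 1/s_1(n) − ⋯ − 1/s_i(n).
sylvPred : ℕ → ℕ → ℕ
sylvPred n zero = n
sylvPred n (suc i) = sylvPred n i ℕ.* suc (sylvPred n i)

sylv≡suc-sylvPred : ∀ n i → sylv n (suc i) ≡ suc (sylvPred n i)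
sylv≡suc-sylvPred n zero = refl
sylv≡suc-sylvPred n (suc i) rewrite sylv≡suc-sylvPred n i =
  -- Truncated subtraction is harmless: (p + 1)(p + 1) unfolds to (p + 1) + p (p + 1).
  trans (cong (ℕ._+ 1) (ℕ.m+n∸m≡n (suc p) (p ℕ.* suc p))) (ℕ.+-comm (p ℕ.* suc p) 1)
  where
  p : ℕ
  p = sylvPred n i

1≤sylvPred : ∀ {n} → 1 ℕ.≤ n → ∀ i → 1 ℕ.≤ sylvPred n i
1≤sylvPred 1≤n zero = 1≤n
1≤sylvPred 1≤n (suc i) = ℕ.*-mono-≤ (1≤sylvPred 1≤n i) (s≤s z≤n)

-- The recursion depends on the previous value alone, so restarting from `sylvPred n k` continues
-- the same sequence.
sylvPred-+ : ∀ n k m → sylvPred (sylvPred n k) m ≡ sylvPred n (m ℕ.+ k)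
sylvPred-+ n k zero = refl
sylvPred-+ n k (suc m) = cong (λ p → p ℕ.* suc p) (sylvPred-+ n k m)

toℚ-sylvPred-suc : ∀ n i → toℚ (sylvPred n (suc i)) ≡ toℚ (sylvPred n i) * (toℚ (sylvPred n i) + 1ℚ)
toℚ-sylvPred-suc n i = trans (toℚ-* p (suc p)) (cong (toℚ p *_) (toℚ-suc p))
  where
  p : ℕ
  p = sylvPred n i

^-2^suc : ∀ x t → x ^ℚ (2 ℕ.^ suc t) ≡ x ^ℚ (2 ℕ.^ t) * x ^ℚ (2 ℕ.^ t)
^-2^suc x t = trans (^-* x 2 (2 ℕ.^ t)) (cong (x ^ℚ (2 ℕ.^ t) *_) (*-identityʳ _))

-- The bounds come from x² ≤ x (x + 1) and x (x + 1) + 1 ≤ (x + 1)². The lower one serves the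
-- Sylvester side, the upper one `U`.
module Growth {f : ℕ → ℚ} (0≤f : ∀ t → 0ℚ ≤ f t) (step : ∀ t → f (suc t) ≡ f t * (f t + 1ℚ)) where

  growth-lower : ∀ t → f 0 ^ℚ (2 ℕ.^ t) ≤ f t
  growth-lower zero = ≤-reflexive (*-identityʳ (f 0))
  growth-lower (suc t) = begin
    f 0 ^ℚ (2 ℕ.^ suc t) ≡⟨ ^-2^suc (f 0) t ⟩
    f 0 ^ℚ (2 ℕ.^ t) * f 0 ^ℚ (2 ℕ.^ t) ≤⟨ *-mono (^-nonNeg (0≤f 0) (2 ℕ.^ t)) (growth-lower t) (0≤f t) (growth-lower t) ⟩
    f t * f t ≤⟨ *-monoˡ (0≤f t) (≤-by 0≤1 refl) ⟩
    f t * (f t + 1ℚ) ≡⟨ sym (step t) ⟩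
    f (suc t) ∎
    where open ≤-Reasoning

  growth-upper : ∀ t → f t + 1ℚ ≤ (f 0 + 1ℚ) ^ℚ (2 ℕ.^ t)
  growth-upper zero = ≤-reflexive (sym (*-identityʳ (f 0 + 1ℚ)))
  growth-upper (suc t) = begin
    f (suc t) + 1ℚ ≡⟨ cong (_+ 1ℚ) (step t) ⟩
    f t * (f t + 1ℚ) + 1ℚ ≤⟨ ≤-by (0≤f t) (square (f t)) ⟩
    (f t + 1ℚ) * (f t + 1ℚ) ≤⟨ *-mono 0≤f+1 (growth-upper t) (^-nonNeg (0≤+ (0≤f 0) 0≤1) (2 ℕ.^ t)) (growth-upper t) ⟩
    (f 0 + 1ℚ) ^ℚ (2 ℕ.^ t) * (f 0 + 1ℚ) ^ℚ (2 ℕ.^ t) ≡⟨ sym (^-2^suc (f 0 + 1ℚ) t) ⟩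
    (f 0 + 1ℚ) ^ℚ (2 ℕ.^ suc t) ∎
    where
    open ≤-Reasoning
    0≤f+1 : 0ℚ ≤ f t + 1ℚ
    0≤f+1 = 0≤+ (0≤f t) 0≤1
    square : ∀ x → x * (x + 1ℚ) + 1ℚ + x ≡ (x + 1ℚ) * (x + 1ℚ)
    square = solve-∀ ring

-- Separating rational roots

archimedean : ∀ p → ∃[ n ] p ≤ toℚ n
archimedean p@(mkℚ z d c) = ℤ.∣ z ∣ , toℚᵘ-cancel-≤ (ℚᵘ.≤-trans (ℚᵘ.*≤* (bound z)) (ℚᵘ.≤-reflexive (ℚᵘ.≃-sym (toℚᵘ-toℚ ℤ.∣ z ∣))))
  where
  bound : ∀ z → z ℤ.* + 1 ℤ.≤ + ℤ.∣ z ∣ ℤ.* + suc d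
  bound (+ n) = subst₂ ℤ._≤_ (ℤ.pos-* n 1) (ℤ.pos-* n (suc d)) (ℤ.+≤+ (ℕ.*-monoʳ-≤ n (s≤s z≤n)))
  bound ℤ.-[1+ n ] = subst (ℤ.-[1+ n ] ℤ.* + 1 ℤ.≤_) (ℤ.pos-* (suc n) (suc d)) ℤ.-≤+

archimedean-* : ∀ {x} → 0ℚ < x → ∀ y → ∃[ n ] y ≤ toℚ n * x
archimedean-* {x} 0<x y with archimedean (y * inv x 0<x)
... | n , le = n , subst (_≤ toℚ n * x) (trans (*-assoc y _ x) (trans (cong (y *_) (trans (*-comm _ x) (inv-inverse x 0<x))) (*-identityʳ y)))
                     (*-monoʳ (<⇒≤ 0<x) le)

-- This is 2ᵉ - 1; the recursion reflects (1 + x)(1 + c x) ≤ 1 + (2 c + 1) x for 0 ≤ x ≤ 1.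
growth-factor : ℕ → ℕ
growth-factor zero = 0
growth-factor (suc e) = growth-factor e ℕ.+ growth-factor e ℕ.+ 1

^-linear-bound : ∀ {x} → 0ℚ ≤ x → x ≤ 1ℚ → ∀ e → (1ℚ + x) ^ℚ e ≤ 1ℚ + toℚ (growth-factor e) * x
^-linear-bound {x} 0≤x x≤1 zero = ≤-reflexive (sym (trans (cong (λ t → 1ℚ + t) (*-zeroˡ x)) (+-identityʳ 1ℚ)))
^-linear-bound {x} 0≤x x≤1 (suc e) = ≤-trans (*-monoˡ (0≤+ 0≤1 0≤x) (^-linear-bound 0≤x x≤1 e))
  (≤-by (0≤* (0≤* (0≤toℚ c) 0≤x) (x≤y⇒0≤y-x x≤1)) (trans (expand (toℚ c) x) (cong (λ t → 1ℚ + t * x) (sym toℚ-c))))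
  where
  c : ℕ
  c = growth-factor e
  toℚ-c : toℚ (c ℕ.+ c ℕ.+ 1) ≡ toℚ c + toℚ c + 1ℚ
  toℚ-c = trans (toℚ-+ (c ℕ.+ c) 1) (cong (_+ 1ℚ) (toℚ-+ c c))
  expand : ∀ c x → (1ℚ + x) * (1ℚ + c * x) + c * x * (1ℚ - x) ≡ 1ℚ + (c + c + 1ℚ) * x
  expand = solve-∀ ring

-- With Δ = H - L and c = `growth-factor e`, the choice x = Δ / (Δ + c L) solves L (1 + c x) + Δ x =
-- H, and x ≤ 1 as `^-linear-bound` requires.
small-power : ∀ {L H} → 0ℚ ≤ L → L < H → ∀ e → ∃[ x ] (0ℚ < x × L * (1ℚ + x) ^ℚ e ≤ H)
small-power {L} {H} 0≤L L<H e = x , 0<x , ≤-trans (*-monoˡ 0≤L (^-linear-bound (<⇒≤ 0<x) x≤1 e))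
  (≤-by (0≤* 0≤Δ (<⇒≤ 0<x)) (trans (expand L H c v) (trans (cong (λ t → L + Δ * t) yv) (final L H))))
  where
  c Δ y : ℚ
  c = toℚ (growth-factor e)
  Δ = H - L
  y = Δ + c * L
  0≤cL : 0ℚ ≤ c * L
  0≤cL = 0≤* (0≤toℚ (growth-factor e)) 0≤L
  0<Δ : 0ℚ < Δ
  0<Δ = x<y⇒0<y-x L<H
  0≤Δ : 0ℚ ≤ Δ
  0≤Δ = <⇒≤ 0<Δ
  0<y : 0ℚ < y
  0<y = 0<+ 0<Δ 0≤cL
  v x : ℚ
  v = inv y 0<y
  x = Δ * v
  yv : y * v ≡ 1ℚ
  yv = inv-inverse y 0<y
  0<x : 0ℚ < x
  0<x = 0<* 0<Δ (0<inv y 0<y)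
  x≤1 : x ≤ 1ℚ
  x≤1 = ≤-by (0≤* 0≤cL (<⇒≤ (0<inv y 0<y))) (trans (sym (*-distribʳ-+ v Δ (c * L))) yv)
  expand : ∀ L H c v → L * (1ℚ + c * ((H - L) * v)) + (H - L) * ((H - L) * v) ≡ L + (H - L) * ((H - L + c * L) * v)
  expand = solve-∀ ring
  final : ∀ L H → L + (H - L) * 1ℚ ≡ H
  final = solve-∀ ring

-- Searches downward from n for the exponent at which the powers of G pass L; 1 ≤ L excludes
-- reaching exponent 0.
power-bracket : ∀ {G L} → 1ℚ ≤ L → ∀ n → L < G ^ℚ n → ∃[ j ] (G ^ℚ j ≤ L × L < G ^ℚ suc j)
power-bracket 1≤L zero L<1 = ⊥-elim (<-irrefl refl (≤-<-trans 1≤L L<1))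
power-bracket {G} {L} 1≤L (suc n) L<G^1+n = by-cases (<-or-≥ L (G ^ℚ n))
  where
  by-cases : L < G ^ℚ n ⊎ G ^ℚ n ≤ L → ∃[ j ] (G ^ℚ j ≤ L × L < G ^ℚ suc j)
  by-cases (inj₁ L<G^n) = power-bracket 1≤L n L<G^n
  by-cases (inj₂ G^n≤L) = n , G^n≤L , L<G^1+n

x≤x^suc : ∀ {x} → 1ℚ ≤ x → ∀ n → x ≤ x ^ℚ suc n
x≤x^suc {x} 1≤x n = subst (_≤ x ^ℚ suc n) (*-identityʳ x)
  (*-monoˡ (≤-trans 0≤1 1≤x) (subst (_≤ x ^ℚ n) (1^ n) (^-mono-≤ 0≤1 1≤x n)))

-- For g = 1 + x with L g³ᴷ ≤ H and gᴷʲ ≤ L < gᴷ⁽ʲ⁺¹⁾, take q = gʲ⁺² and q′ = gʲ⁺³.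
separating-roots : ∀ {L H} → 1ℚ ≤ L → L < H → ∀ K → 1 ℕ.≤ K →
  ∃[ q ] ∃[ q′ ] ∃[ x ] (0ℚ < q × q < q′ × 0ℚ < x × L * (1ℚ + x) ≤ q ^ℚ K × q′ ^ℚ K ≤ H)
separating-roots {L} {H} 1≤L L<H (suc k) _ = from-power (small-power (≤-trans 0≤1 1≤L) L<H (K ℕ.* 3))
  where
  K : ℕ
  K = suc k
  Goal : Set
  Goal = ∃[ q ] ∃[ q′ ] ∃[ x ] (0ℚ < q × q < q′ × 0ℚ < x × L * (1ℚ + x) ≤ q ^ℚ K × q′ ^ℚ K ≤ H)
  from-power : ∃[ x ] (0ℚ < x × L * (1ℚ + x) ^ℚ (K ℕ.* 3) ≤ H) → Goal
  from-power (x , 0<x , L*g^3K≤H) = from-archimedean (archimedean-* 0<x L)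
    where
    g G : ℚ
    g = 1ℚ + x
    G = g ^ℚ K
    1≤g : 1ℚ ≤ g
    1≤g = ≤-by (<⇒≤ 0<x) refl
    0<g : 0ℚ < g
    0<g = <-≤-trans 0<1 1≤g
    g≤G : g ≤ G
    g≤G = x≤x^suc 1≤g k
    ^-swap : ∀ j → (g ^ℚ j) ^ℚ K ≡ G ^ℚ j
    ^-swap j = trans (sym (^-* g K j)) (trans (cong (g ^ℚ_) (ℕ.*-comm K j)) (^-* g j K))
    from-bracket : ∃[ j ] (G ^ℚ j ≤ L × L < G ^ℚ suc j) → Goal
    from-bracket (j , G^j≤L , L<G^1+j) = g ^ℚ (2 ℕ.+ j) , g ^ℚ (3 ℕ.+ j) , x , ^-pos 0<g (2 ℕ.+ j)
      , <-by (0<* 0<x (^-pos 0<g (2 ℕ.+ j))) (factor x (g ^ℚ (2 ℕ.+ j)))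
      , 0<x , lower , upper
      where
      open ≤-Reasoning
      factor : ∀ x y → y + x * y ≡ (1ℚ + x) * y
      factor = solve-∀ ring
      lower : L * g ≤ (g ^ℚ (2 ℕ.+ j)) ^ℚ K
      lower = begin
        L * g ≤⟨ *-mono (≤-trans 0≤1 1≤L) (<⇒≤ L<G^1+j) (^-nonNeg (<⇒≤ 0<g) K) g≤G ⟩
        G ^ℚ suc j * G ≡⟨ *-comm (G ^ℚ suc j) G ⟩
        G ^ℚ (2 ℕ.+ j) ≡⟨ sym (^-swap (2 ℕ.+ j)) ⟩
        (g ^ℚ (2 ℕ.+ j)) ^ℚ K ∎
      upper : (g ^ℚ (3 ℕ.+ j)) ^ℚ K ≤ H
      upper = begin
        (g ^ℚ (3 ℕ.+ j)) ^ℚ K ≡⟨ ^-swap (3 ℕ.+ j) ⟩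
        G ^ℚ (3 ℕ.+ j) ≡⟨ ^-+ G 3 j ⟩
        G ^ℚ 3 * G ^ℚ j ≡⟨ *-comm (G ^ℚ 3) (G ^ℚ j) ⟩
        G ^ℚ j * G ^ℚ 3 ≤⟨ *-monoʳ (^-nonNeg (^-nonNeg (<⇒≤ 0<g) K) 3) G^j≤L ⟩
        L * G ^ℚ 3 ≡⟨ cong (L *_) (trans (sym (^-swap 3)) (sym (^-* g K 3))) ⟩
        L * g ^ℚ (K ℕ.* 3) ≤⟨ L*g^3K≤H ⟩
        H ∎
    from-archimedean : ∃[ n ] L ≤ toℚ n * x → Goal
    -- L < 1 + n x ≤ gⁿ ≤ Gⁿ bounds the search for j.
    from-archimedean (n , L≤n*x) = from-bracket (power-bracket 1≤L n (begin-strict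
      L ≤⟨ L≤n*x ⟩
      toℚ n * x <⟨ <-by 0<1 (+-comm (toℚ n * x) 1ℚ) ⟩
      1ℚ + toℚ n * x ≤⟨ bernoulli (<⇒≤ 0<x) n ⟩
      g ^ℚ n ≤⟨ ^-mono-≤ (<⇒≤ 0<g) g≤G n ⟩
      G ^ℚ n ∎))
      where open ≤-Reasoning

-- Separation of U from the Sylvester sequence

module Gap (S : ℕ) (1≤S : 1 ℕ.≤ S) where

  open Deviation S 1≤S

  -- The Sylvester counterpart of `U`: 1 / `T i` is what is left of 1/S after its first i + 2
  -- Sylvester terms.
  T : ℕ → ℚ
  T i = toℚ (sylvPred S (suc (suc i)))

  T₀≡ : T 0 ≡ s * (s + 1ℚ) * (s * (s + 1ℚ) + 1ℚ)
  T₀≡ = trans (toℚ-sylvPred-suc S 1) (cong (λ t → t * (t + 1ℚ)) (toℚ-sylvPred-suc S 0))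

  6≤T₀ : toℚ 6 ≤ T 0
  6≤T₀ = toℚ-mono-≤ (ℕ.*-mono-≤ 2≤S₁ (s≤s 2≤S₁))
    where
    2≤S₁ : 2 ℕ.≤ sylvPred S 1
    2≤S₁ = ℕ.*-mono-≤ 1≤S (s≤s 1≤S)

  -- The expression factors as (s - 1)(s + 1)(2 s² + 1). So T₀ - U₀ ≥ 1/6, with equality at S = 1,
  -- where T₀ = 6 and U₀ = 35/6.
  0≤6[T₀-U₀]-1 : 0ℚ ≤ toℚ 6 * (T 0 - U 0) - 1ℚ
  0≤6[T₀-U₀]-1 = subst (0ℚ ≤_) (sym (trans (cong (λ t → toℚ 6 * (t - U 0) - 1ℚ) T₀≡) (factor s)))
    (0≤* (0≤* (x≤y⇒0≤y-x 1≤s) (0≤+ 0≤s 0≤1)) (0≤+ (0≤* (0≤* (<⇒≤ 0<2) 0≤s) 0≤s) 0≤1))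
    where
    0≤s : 0ℚ ≤ s
    0≤s = <⇒≤ 0<s
    factor : ∀ s → toℚ 6 * (s * (s + 1ℚ) * (s * (s + 1ℚ) + 1ℚ) - s * (2ℚ * s + 3ℚ) * (2ℚ * s * s + 3ℚ * s + 2ℚ) * recip 6) - 1ℚ
      ≡ (s - 1ℚ) * (s + 1ℚ) * (2ℚ * s * s + 1ℚ)
    factor = solve-∀ ring

  -- T₁ - U₁ = d (T₀ + U₀ + 1) with d = T₀ - U₀ ≥ 1/6 and T₀ ≥ 6, so it exceeds 1. The growth bounds
  -- start from U₁ + 1 and T₁; the analogous inequality at index 0 fails for S = 1.
  U₁+1<T₁ : U 1 + 1ℚ < T 1
  U₁+1<T₁ = subst (U 1 + 1ℚ <_) (sym (toℚ-sylvPred-suc S 2))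
    (<-by (0<+ 0<d (0≤+ (0≤+ (0≤* 0≤d (x≤y⇒0≤y-x 6≤T₀)) (0≤* 0≤d (<⇒≤ (0<U 0)))) 0≤6[T₀-U₀]-1)) (eq (T 0) (U 0)))
    where
    d : ℚ
    d = T 0 - U 0
    0<d : 0ℚ < d
    0<d = cancel-0< (0≤toℚ 6) (<-by (0<+ 0<1 0≤6[T₀-U₀]-1) (back (toℚ 6 * d)))
      where
      back : ∀ x → 0ℚ + (1ℚ + (x - 1ℚ)) ≡ x
      back = solve-∀ ring
    0≤d : 0ℚ ≤ d
    0≤d = <⇒≤ 0<d
    eq : ∀ T U → U * (U + 1ℚ) + 1ℚ + (T - U + ((T - U) * (T - toℚ 6) + (T - U) * U + (toℚ 6 * (T - U) - 1ℚ))) ≡ T * (T + 1ℚ)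
    eq = solve-∀ ring

  module U-growth = Growth {λ t → U (suc t)} (λ t → <⇒≤ (0<U (suc t))) (λ t → refl)
  module T-growth = Growth {λ t → T (suc t)} (λ t → 0≤toℚ (sylvPred S (suc (suc (suc t))))) (λ t → toℚ-sylvPred-suc S (suc (suc (suc t))))

  1≤U₁+1 : 1ℚ ≤ U 1 + 1ℚ
  1≤U₁+1 = ≤-by (<⇒≤ (0<U 1)) (+-comm 1ℚ (U 1))

-- The tail after the first deviation

partialSum≡sum : ∀ a m → partialSum a m ≡ sum (λ i → recip (a (suc i))) m
partialSum≡sum a zero = refl
partialSum≡sum a (suc m) = cong (_+ recip (a (suc m))) (partialSum≡sum a m)

sum-shift : ∀ f k m → sum f (m ℕ.+ k) ≡ sum f k + sum (λ i → f (i ℕ.+ k)) m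
sum-shift f k zero = sym (+-identityʳ (sum f k))
sum-shift f k (suc m) = trans (cong (_+ f (m ℕ.+ k)) (sum-shift f k m)) (+-assoc (sum f k) _ _)

x≤∣x∣ : ∀ x → x ≤ ∣ x ∣
x≤∣x∣ x = by-cases (≤-total 0ℚ x)
  where
  by-cases : 0ℚ ≤ x ⊎ x ≤ 0ℚ → x ≤ ∣ x ∣
  by-cases (inj₁ 0≤x) = ≤-reflexive (sym (0≤p⇒∣p∣≡p 0≤x))
  by-cases (inj₂ x≤0) = ≤-trans x≤0 (0≤∣p∣ x)

ConvergesTo : (ℕ → ℚ) → ℚ → Set
ConvergesTo u r = ∀ ε → 0ℚ < ε → ∃[ N ] (∀ m → N ℕ.≤ m → ∣ u m - r ∣ < ε)

-- If the sum reached r after m terms, the next term would keep all later sums at least `f m` above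
-- r, against closeness within ε = `f m`.
convergent-sum<limit : ∀ f r → (∀ i → 0ℚ < f i) → ConvergesTo (sum f) r → ∀ m → sum f m < r
convergent-sum<limit f r 0<f conv m = ≰⇒> λ r≤sum → overshoot r≤sum (conv (f m) (0<f m))
  where
  overshoot : r ≤ sum f m → ¬ (∃[ N ] (∀ k → N ℕ.≤ k → ∣ sum f k - r ∣ < f m))
  overshoot r≤sum (N , close) = <-irrefl refl (≤-<-trans (≤-trans f≤ (x≤∣x∣ _)) (close (N ℕ.+ suc m) (ℕ.m≤m+n N (suc m))))
    where
    later : ℚ
    later = sum (λ i → f (i ℕ.+ suc m)) N
    eq : ∀ r s x l → x + (s - r + l) ≡ s + x + l - r
    eq = solve-∀ ring
    f≤ : f m ≤ sum f (N ℕ.+ suc m) - r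
    f≤ = ≤-by (0≤+ (x≤y⇒0≤y-x r≤sum) (0≤sum (λ i → <⇒≤ (0<f (i ℕ.+ suc m))) N))
      (trans (eq r (sum f m) (f m) later) (cong (_- r) (sym (sum-shift f (suc m) N))))

recip-split : ∀ y → 1 ℕ.≤ y → recip (suc y) + recip (y ℕ.* suc y) ≡ recip y
recip-split y 1≤y = begin
  v + w ≡⟨ sym (ones v w) ⟩
  v * 1ℚ + w * 1ℚ * 1ℚ ≡⟨ cong₂ (λ e f → v * e + w * e * f) (sym yu) (sym 1+yv) ⟩
  v * (t * u) + w * (t * u) * ((t + 1ℚ) * v) ≡⟨ regroup t u v w ⟩
  u * (t * v + t * (t + 1ℚ) * w * v) ≡⟨ cong (λ e → u * (t * v + e * v)) y[1+y]w ⟩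
  u * (t * v + 1ℚ * v) ≡⟨ cong (u *_) (trans (sym (*-distribʳ-+ v t 1ℚ)) 1+yv) ⟩
  u * 1ℚ ≡⟨ *-identityʳ u ⟩
  u ∎
  where
  open ≡-Reasoning
  t u v w : ℚ
  t = toℚ y
  u = recip y
  v = recip (suc y)
  w = recip (y ℕ.* suc y)
  yu : t * u ≡ 1ℚ
  yu = toℚ*recip y 1≤y
  1+yv : (t + 1ℚ) * v ≡ 1ℚ
  1+yv = trans (cong (_* v) (sym (toℚ-suc y))) (toℚ*recip (suc y) (s≤s z≤n))
  y[1+y]w : t * (t + 1ℚ) * w ≡ 1ℚ
  y[1+y]w = trans (cong (_* w) (sym (trans (toℚ-* y (suc y)) (cong (t *_) (toℚ-suc y))))) (toℚ*recip (y ℕ.* suc y) (ℕ.*-mono-≤ 1≤y (s≤s z≤n)))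
  ones : ∀ v w → v * 1ℚ + w * 1ℚ * 1ℚ ≡ v + w
  ones = solve-∀ ring
  regroup : ∀ t u v w → v * (t * u) + w * (t * u) * ((t + 1ℚ) * v) ≡ u * (t * v + t * (t + 1ℚ) * w * v)
  regroup = solve-∀ ring

sylvester-sum : ∀ n (c : ℕ → ℕ) → 1 ℕ.≤ n → ∀ k → (∀ j → j ℕ.< k → c j ≡ suc (sylvPred n j)) →
  sum (recip ∘ c) k + recip (sylvPred n k) ≡ recip n
sylvester-sum n c 1≤n zero _ = +-identityˡ (recip n)
sylvester-sum n c 1≤n (suc k) agree = begin
  σ + recip (c k) + recip (sylvPred n (suc k)) ≡⟨ +-assoc σ (recip (c k)) (recip (sylvPred n (suc k))) ⟩
  σ + (recip (c k) + recip (sylvPred n (suc k))) ≡⟨ cong (λ x → σ + (recip x + recip (sylvPred n (suc k)))) (agree k ℕ.≤-refl) ⟩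
  σ + (recip (suc (sylvPred n k)) + recip (sylvPred n (suc k))) ≡⟨ cong (λ x → σ + x) (recip-split (sylvPred n k) (1≤sylvPred 1≤n k)) ⟩
  σ + recip (sylvPred n k) ≡⟨ sylvester-sum n c 1≤n k (λ j j<k → agree j (ℕ.m≤n⇒m≤1+n j<k)) ⟩
  recip n ∎
  where
  open ≡-Reasoning
  σ : ℚ
  σ = sum (recip ∘ c) k

recip-cancel-< : ∀ {x y} → 1 ℕ.≤ x → 1 ℕ.≤ y → recip x < recip y → y ℕ.< x
recip-cancel-< {x} {y} 1≤x 1≤y lt = ℕ.≰⇒> λ x≤y → <-irrefl refl (<-≤-trans lt
  (subst₂ _≤_ (*-identityˡ _) (*-identityˡ _)
    (reciprocal-anti (toℚ y) (recip y) (toℚ x) (recip x) 1ℚ 1ℚ (0≤recip y) (0≤recip x) (toℚ*recip y 1≤y) (toℚ*recip x 1≤x)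
      (*-monoˡ 0≤1 (toℚ-mono-≤ x≤y)))))

first-disagreement : ∀ (f g : ℕ → ℕ) m → f m ≢ g m → ∃[ k ] ((∀ j → j ℕ.< k → f j ≡ g j) × f k ≢ g k)
first-disagreement f g m fm≢gm = by-cases (agree-below m)
  where
  Goal : Set
  Goal = ∃[ k ] ((∀ j → j ℕ.< k → f j ≡ g j) × f k ≢ g k)
  agree-below : ∀ m → (∀ j → j ℕ.< m → f j ≡ g j) ⊎ Goal
  agree-below zero = inj₁ λ _ ()
  agree-below (suc m) with agree-below m | f m ℕ.≟ g m
  ... | inj₂ found | _ = inj₂ found
  ... | inj₁ agree | no f≢g = inj₂ (m , agree , f≢g)
  ... | inj₁ agree | yes f≡g = inj₁ λ j j<1+m → extend (ℕ.m≤n⇒m<n∨m≡n (ℕ.≤-pred j<1+m))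
    where
    extend : ∀ {j} → j ℕ.< m ⊎ j ≡ m → f j ≡ g j
    extend (inj₁ j<m) = agree _ j<m
    extend (inj₂ refl) = f≡g
  by-cases : (∀ j → j ℕ.< m → f j ≡ g j) ⊎ Goal → Goal
  by-cases (inj₁ agree) = m , agree , fm≢gm
  by-cases (inj₂ found) = found

n≤2^n : ∀ n → n ℕ.≤ 2 ℕ.^ n
n≤2^n zero = z≤n
n≤2^n (suc n) = ℕ.+-mono-≤ (ℕ.m^n>0 2 n) (ℕ.≤-trans (n≤2^n n) (ℕ.m≤m+n (2 ℕ.^ n) 0))

module FirstDeviation (n : ℕ) (1≤n : 1 ℕ.≤ n) (c : ℕ → ℕ) (1≤c : ∀ i → 1 ℕ.≤ c i) (c-mono : ∀ i → c i ℕ.≤ c (suc i))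
  (converges : ConvergesTo (sum (recip ∘ c)) (recip n))
  (k : ℕ) (agree : ∀ j → j ℕ.< k → c j ≡ suc (sylvPred n j)) (c-k≢ : c k ≢ suc (sylvPred n k)) where

  S : ℕ
  S = sylvPred n k

  1≤S : 1 ℕ.≤ S
  1≤S = 1≤sylvPred 1≤n k

  open Deviation S 1≤S
  open Gap S 1≤S

  b : ℕ → ℕ
  b i = c (i ℕ.+ k)

  remainder-shift : ∀ m → recip n - sum (recip ∘ c) (m ℕ.+ k) ≡ recip S - sum (recip ∘ b) m
  remainder-shift m = trans (cong₂ _-_ (sym (sylvester-sum n c 1≤n k agree)) (sum-shift (recip ∘ c) k m))
    (cancel (sum (recip ∘ c) k) (recip S) (sum (recip ∘ b) m))
    where
    cancel : ∀ x r y → x + r - (x + y) ≡ r - y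
    cancel = solve-∀ ring

  under : ∀ m → sum (recip ∘ b) m < recip S
  under m = <-by (subst (0ℚ <_) (remainder-shift m)
      (x<y⇒0<y-x (convergent-sum<limit (recip ∘ c) (recip n) (λ i → 0<recip (c i) (1≤c i)) converges (m ℕ.+ k))))
    (x+[y-x]≡y (sum (recip ∘ b) m) (recip S))

  b-converges : ∀ ε → 0ℚ < ε → ∃[ M ] (∀ m → M ℕ.≤ m → recip S - sum (recip ∘ b) m < ε)
  b-converges ε 0<ε = from-close (converges ε 0<ε)
    where
    negate : ∀ x y → - (x - y) ≡ y - x
    negate = solve-∀ ring
    from-close : ∃[ M ] (∀ m → M ℕ.≤ m → ∣ sum (recip ∘ c) m - recip n ∣ < ε) → ∃[ M ] (∀ m → M ℕ.≤ m → recip S - sum (recip ∘ b) m < ε)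
    from-close (M , close) = M , λ m M≤m → subst (_< ε)
      (trans (negate (sum (recip ∘ c) (m ℕ.+ k)) (recip n)) (remainder-shift m))
      (≤-<-trans (≤-trans (x≤∣x∣ _) (≤-reflexive (∣-p∣≡∣p∣ _))) (close (m ℕ.+ k) (ℕ.≤-trans M≤m (ℕ.m≤m+n m k))))

  -- The first reciprocal lies below 1/S, which forces b₀ > S, and the disagreement at k excludes b₀
  -- = S + 1.
  S+2≤b₀ : S ℕ.+ 2 ℕ.≤ b 0
  S+2≤b₀ = subst (ℕ._≤ b 0) (ℕ.+-comm 2 S) (ℕ.≤∧≢⇒< S<b₀ (λ eq → c-k≢ (sym eq)))
    where
    S<b₀ : S ℕ.< b 0
    S<b₀ = recip-cancel-< (1≤c k) 1≤S (subst (_< recip S) (+-identityˡ (recip (b 0))) (under 1))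

  often-small : ∀ N → ∃[ i ] (N ℕ.≤ i × toℚ (b (suc (suc i))) < 2ℚ * (U i + 1ℚ))
  often-small = infinitely-often-small b (λ i → 1≤c (i ℕ.+ k)) (λ i → c-mono (i ℕ.+ k)) S+2≤b₀ under b-converges

  -- The term compared with 2 (U (t + 1) + 1) is b (t + 3) = c (t + 3 + k). Its exponent is 2^(t + 4
  -- + k), as `c` is indexed from 0. This equals 2ᵗ · 2ᴱ, and 2ᵗ is the exponent in the growth
  -- bounds started at index 1.
  E : ℕ
  E = 4 ℕ.+ k

  exponent : ∀ t → 2 ℕ.^ (4 ℕ.+ (t ℕ.+ k)) ≡ 2 ℕ.^ t ℕ.* 2 ℕ.^ E
  exponent t = trans (cong (2 ℕ.^_) (eq t)) (ℕ.^-distribˡ-+-* 2 t E)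
    where
    eq : ∀ t → 4 ℕ.+ (t ℕ.+ k) ≡ t ℕ.+ E
    eq t = trans (sym (ℕ.+-assoc 4 t k)) (trans (cong (ℕ._+ k) (ℕ.+-comm 4 t)) (ℕ.+-assoc t 4 k))

  ^-exponent : ∀ x t → x ^ℚ (2 ℕ.^ (4 ℕ.+ (t ℕ.+ k))) ≡ (x ^ℚ (2 ℕ.^ E)) ^ℚ (2 ℕ.^ t)
  ^-exponent x t = trans (cong (x ^ℚ_) (exponent t)) (^-* x (2 ℕ.^ t) (2 ℕ.^ E))

  Conclusion : Set
  Conclusion = ∃[ q ] ∃[ q′ ] (0ℚ < q × q < q′
    × (∀ N → ∃[ i ] (N ℕ.≤ i × toℚ (c i) < q ^ℚ (2 ℕ.^ suc i)))
    × ∃[ J ] (∀ i → J ℕ.≤ i → q′ ^ℚ (2 ℕ.^ suc i) < toℚ (suc (sylvPred n i))))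

  conclusion : Conclusion
  conclusion = from-roots (separating-roots 1≤U₁+1 U₁+1<T₁ (2 ℕ.^ E) (ℕ.m^n>0 2 E))
    where
    from-roots : ∃[ q ] ∃[ q′ ] ∃[ x ] (0ℚ < q × q < q′ × 0ℚ < x × (U 1 + 1ℚ) * (1ℚ + x) ≤ q ^ℚ (2 ℕ.^ E) × q′ ^ℚ (2 ℕ.^ E) ≤ T 1) → Conclusion
    from-roots (q , q′ , x , 0<q , q<q′ , 0<x , lower , upper) = q , q′ , 0<q , q<q′
        , (λ N → from-small N (archimedean-* 0<x 1ℚ)) , (3 ℕ.+ k) , sylvester-large
      where
      open ≤-Reasoning
      0≤q′ : 0ℚ ≤ q′
      0≤q′ = <⇒≤ (<-trans 0<q q<q′)
      0≤U₁+1 : 0ℚ ≤ U 1 + 1ℚ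
      0≤U₁+1 = ≤-trans 0≤1 1≤U₁+1
      0≤1+x : 0ℚ ≤ 1ℚ + x
      0≤1+x = 0≤+ 0≤1 (<⇒≤ 0<x)
      -- The margin 1 + x between U₁ + 1 and q^(2ᴱ), raised to the power 2ᵗ, eventually absorbs the
      -- constant factor 2.
      doubling : ∀ t₀ t → 1ℚ ≤ toℚ t₀ * x → t₀ ℕ.≤ t → 2ℚ ≤ (1ℚ + x) ^ℚ (2 ℕ.^ t)
      doubling t₀ t 1≤t₀x t₀≤t = begin
        1ℚ + 1ℚ ≤⟨ +-monoʳ-≤ 1ℚ (≤-trans 1≤t₀x (*-monoʳ (<⇒≤ 0<x) (toℚ-mono-≤ (ℕ.≤-trans t₀≤t (n≤2^n t))))) ⟩
        1ℚ + toℚ (2 ℕ.^ t) * x ≤⟨ bernoulli (<⇒≤ 0<x) (2 ℕ.^ t) ⟩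
        (1ℚ + x) ^ℚ (2 ℕ.^ t) ∎
      q-large : ∀ t → 2ℚ ≤ (1ℚ + x) ^ℚ (2 ℕ.^ t) → 2ℚ * (U (suc t) + 1ℚ) ≤ q ^ℚ (2 ℕ.^ (4 ℕ.+ (t ℕ.+ k)))
      q-large t 2≤ = begin
        2ℚ * (U (suc t) + 1ℚ) ≤⟨ *-mono (<⇒≤ 0<2) 2≤ (^-nonNeg 0≤U₁+1 (2 ℕ.^ t)) (U-growth.growth-upper t) ⟩
        (1ℚ + x) ^ℚ (2 ℕ.^ t) * (U 1 + 1ℚ) ^ℚ (2 ℕ.^ t) ≡⟨ *-comm ((1ℚ + x) ^ℚ (2 ℕ.^ t)) ((U 1 + 1ℚ) ^ℚ (2 ℕ.^ t)) ⟩
        (U 1 + 1ℚ) ^ℚ (2 ℕ.^ t) * (1ℚ + x) ^ℚ (2 ℕ.^ t) ≡⟨ sym (*-^ (U 1 + 1ℚ) (1ℚ + x) (2 ℕ.^ t)) ⟩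
        ((U 1 + 1ℚ) * (1ℚ + x)) ^ℚ (2 ℕ.^ t) ≤⟨ ^-mono-≤ (0≤* 0≤U₁+1 0≤1+x) lower (2 ℕ.^ t) ⟩
        (q ^ℚ (2 ℕ.^ E)) ^ℚ (2 ℕ.^ t) ≡⟨ sym (^-exponent q t) ⟩
        q ^ℚ (2 ℕ.^ (4 ℕ.+ (t ℕ.+ k))) ∎
      from-small : ∀ N → ∃[ t₀ ] 1ℚ ≤ toℚ t₀ * x → ∃[ i ] (N ℕ.≤ i × toℚ (c i) < q ^ℚ (2 ℕ.^ suc i))
      -- An index of at least N + t₀ + 1 is t + 1 with t ≥ N and t ≥ t₀: the successor because
      -- growth starts at `U 1`, t₀ because of `doubling`.
      from-small N (t₀ , 1≤t₀x) = from-often (often-small (suc (N ℕ.+ t₀)))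
        where
        from-often : ∃[ i ] (suc (N ℕ.+ t₀) ℕ.≤ i × toℚ (b (suc (suc i))) < 2ℚ * (U i + 1ℚ)) → ∃[ i ] (N ℕ.≤ i × toℚ (c i) < q ^ℚ (2 ℕ.^ suc i))
        from-often (suc t , s≤s N+t₀≤t , small) = 3 ℕ.+ (t ℕ.+ k)
          , ℕ.≤-trans (ℕ.m≤m+n N t₀) (ℕ.≤-trans N+t₀≤t (ℕ.≤-trans (ℕ.m≤m+n t k) (ℕ.m≤n+m (t ℕ.+ k) 3)))
          , <-≤-trans small (q-large t (doubling t₀ t 1≤t₀x (ℕ.≤-trans (ℕ.m≤n+m t₀ N) N+t₀≤t)))
      sylvester-bound : ∀ t → q′ ^ℚ (2 ℕ.^ (4 ℕ.+ (t ℕ.+ k))) < toℚ (suc (sylvPred n (3 ℕ.+ (t ℕ.+ k))))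
      sylvester-bound t = begin-strict
        q′ ^ℚ (2 ℕ.^ (4 ℕ.+ (t ℕ.+ k))) ≡⟨ ^-exponent q′ t ⟩
        (q′ ^ℚ (2 ℕ.^ E)) ^ℚ (2 ℕ.^ t) ≤⟨ ^-mono-≤ (^-nonNeg 0≤q′ (2 ℕ.^ E)) upper (2 ℕ.^ t) ⟩
        T 1 ^ℚ (2 ℕ.^ t) ≤⟨ T-growth.growth-lower t ⟩
        toℚ (sylvPred S (3 ℕ.+ t)) ≡⟨ cong toℚ (sylvPred-+ n k (3 ℕ.+ t)) ⟩
        toℚ (sylvPred n (3 ℕ.+ (t ℕ.+ k))) <⟨ toℚ-mono-< (ℕ.n<1+n (sylvPred n (3 ℕ.+ (t ℕ.+ k)))) ⟩
        toℚ (suc (sylvPred n (3 ℕ.+ (t ℕ.+ k)))) ∎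
      sylvester-large : ∀ i → 3 ℕ.+ k ℕ.≤ i → q′ ^ℚ (2 ℕ.^ suc i) < toℚ (suc (sylvPred n i))
      sylvester-large i 3+k≤i = subst (λ i → q′ ^ℚ (2 ℕ.^ suc i) < toℚ (suc (sylvPred n i))) index (sylvester-bound t)
        where
        t : ℕ
        t = i ℕ.∸ (3 ℕ.+ k)
        index : 3 ℕ.+ (t ℕ.+ k) ≡ i
        index = trans (trans (sym (ℕ.+-assoc 3 t k)) (trans (cong (ℕ._+ k) (ℕ.+-comm 3 t)) (ℕ.+-assoc t 3 k))) (ℕ.m∸n+n≡m 3+k≤i)

-- Rational separators express the inequality without real limits: aᵢ^(2^(-i)) < q infinitely often
-- and q′ < sᵢ^(2^(-i)) eventually, so the lower limit is at most q < q′ ≤ cₙ.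
theorem2p6 : (n : ℕ) → 1 ℕ.≤ n → (a : ℕ → ℕ)
    → (∀ i → 1 ℕ.≤ i → 1 ℕ.≤ a i)
    → (∀ i → 1 ℕ.≤ i → a i ℕ.≤ a (suc i))
    → (∀ (ε : ℚ) → 0ℚ < ε → ∃[ N ] (∀ m → N ℕ.≤ m → ∣ partialSum a m - recip n ∣ < ε))
    → (∃[ i ] (1 ℕ.≤ i × a i ≢ sylv n i))
    → ∃[ q ] ∃[ q′ ] (0ℚ < q × q < q′
    × (∀ N → ∃[ i ] (N ℕ.≤ i × toℚ (a i) < q ^ℚ (2 ℕ.^ i)))
    × ∃[ J ] (∀ j → J ℕ.≤ j → q′ ^ℚ (2 ℕ.^ j) < toℚ (sylv n j)))
theorem2p6 n 1≤n a 1≤a a-mono converges (suc i , _ , a≢sylv) =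
  from-first (first-disagreement c (λ j → suc (sylvPred n j)) i λ eq → a≢sylv (trans eq (sym (sylv≡suc-sylvPred n i))))
  where
  c : ℕ → ℕ
  c j = a (suc j)
  c-converges : ConvergesTo (sum (recip ∘ c)) (recip n)
  c-converges ε 0<ε = from-close (converges ε 0<ε)
    where
    from-close : ∃[ N ] (∀ m → N ℕ.≤ m → ∣ partialSum a m - recip n ∣ < ε) → ∃[ N ] (∀ m → N ℕ.≤ m → ∣ sum (recip ∘ c) m - recip n ∣ < ε)
    from-close (N , close) = N , λ m N≤m → subst (λ s → ∣ s - recip n ∣ < ε) (partialSum≡sum a m) (close m N≤m)
  Goal : Set
  Goal = ∃[ q ] ∃[ q′ ] (0ℚ < q × q < q′
    × (∀ N → ∃[ i ] (N ℕ.≤ i × toℚ (a i) < q ^ℚ (2 ℕ.^ i)))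
    × ∃[ J ] (∀ j → J ℕ.≤ j → q′ ^ℚ (2 ℕ.^ j) < toℚ (sylv n j)))
  from-first : ∃[ k ] ((∀ j → j ℕ.< k → c j ≡ suc (sylvPred n j)) × c k ≢ suc (sylvPred n k)) → Goal
  from-first (k , agree , c-k≢) = reindex (FirstDeviation.conclusion n 1≤n c (λ i → 1≤a (suc i) (s≤s z≤n))
      (λ i → a-mono (suc i) (s≤s z≤n)) c-converges k agree c-k≢)
    where
    reindex : ∃[ q ] ∃[ q′ ] (0ℚ < q × q < q′
        × (∀ N → ∃[ i ] (N ℕ.≤ i × toℚ (c i) < q ^ℚ (2 ℕ.^ suc i)))
        × ∃[ J ] (∀ i → J ℕ.≤ i → q′ ^ℚ (2 ℕ.^ suc i) < toℚ (suc (sylvPred n i)))) → Goal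
    reindex (q , q′ , 0<q , q<q′ , often , J , large) = q , q′ , 0<q , q<q′ , often′ , suc J , large′
      where
      often′ : ∀ N → ∃[ i ] (N ℕ.≤ i × toℚ (a i) < q ^ℚ (2 ℕ.^ i))
      often′ N = shift (often N)
        where
        shift : ∃[ i ] (N ℕ.≤ i × toℚ (c i) < q ^ℚ (2 ℕ.^ suc i)) → ∃[ i ] (N ℕ.≤ i × toℚ (a i) < q ^ℚ (2 ℕ.^ i))
        shift (i , N≤i , small) = suc i , ℕ.m≤n⇒m≤1+n N≤i , small
      large′ : ∀ j → suc J ℕ.≤ j → q′ ^ℚ (2 ℕ.^ j) < toℚ (sylv n j)
      large′ (suc j) (s≤s J≤j) = subst (λ s → q′ ^ℚ (2 ℕ.^ suc j) < toℚ s) (sym (sylv≡suc-sylvPred n j)) (large j J≤j)
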